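{- Let $(G,\sigma)$ be a finite connected signed graph satisfying $CD^{\sigma}(K,N)$ for some $K\in\mathbb{R}$ and $N\in(0,\infty]$. Let $f:V\to\mathbb{R}$ be an eigenfunction of the signed Laplacian $\Delta^{\sigma}$ to a nonzero eigenvalue $\lambda^{\sigma}$, i.e. $-\Delta^\sigma f=\lambda^\sigma f$. Then for all $x\in V$ and all $\alpha>2-2K/\lambda^{\sigma}$, \[ |\nabla^{\sigma}f|^{2}(x)+\alpha\lambda^{\sigma} f^{2}(x)\leq\frac{(\alpha^{2}-\frac{4}{N})\lambda^{\sigma}+2K\alpha}{(\alpha-2)\lambda^{\sigma}+2K}\,\lambda^{\sigma}\cdot \max_{z\in V}f^{2}(z), \] with the convention $\frac1N=0$ if $N=\infty$.
   Context: $G=(V,E)$ is a finite simple connected graph; $x\sim y$ means $\{x,y\}\in E$; $d_x$ is the degree of $x$. A sign is a map $\sigma:E\to\{ -1,+1\}$, $\sigma_{xy}:=\sigma(\{x,y\})$; $(G,\sigma)$ is a signed graph. The signed Laplacian is $\Delta^{\sigma}f(x)=\frac{1}{d_x}\sum_{y\sim x}(\sigma_{xy}f(y)-f(x))$, and $\Delta$ denotes the same operator with $\sigma\equiv+1$. For $f,g:V\to\mathbb{R}$: $\Gamma^{\sigma}(f,g)=\frac12\{\Delta(fg)-g\Delta^{\sigma}f-f\Delta^{\sigma}g\}$, $\Gamma_2^{\sigma}(f,g)=\frac12\{\Delta\Gamma^{\sigma}(f,g)-\Gamma^{\sigma}(g,\Delta^{\sigma}f)-\Gamma^{\sigma}(f,\Delta^{\sigma}g)\}$,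 $\Gamma^\sigma(f)=\Gamma^\sigma(f,f)$, $\Gamma_2^\sigma(f)=\Gamma_2^\sigma(f,f)$, and $|\nabla^{\sigma}f|^2(x):=2\Gamma^\sigma(f)(x)=\frac{1}{d_x}\sum_{y\sim x}(\sigma_{xy}f(y)-f(x))^2$. $(G,\sigma)$ satisfies $CD^{\sigma}(K,N)$ ($K\in\mathbb{R}$, $N\in(0,\infty]$) if $\Gamma_2^{\sigma}(f)(x)\ge\frac1N(\Delta^\sigma f)^2(x)+K\Gamma^\sigma(f)(x)$ for all $f:V\to\mathbb{R}$ and all $x\in V$ (with $\frac1N=0$ for $N=\infty$). -}

module Defs where

open import Level using (Level; _⊔_; 0ℓ) renaming (suc to lsuc)
open import Algebra.Bundles using (CommutativeRing)
import Algebra.Definitions.RawMonoid as RawMonoidDefs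
open import Data.Fin.Base using (Fin; zero; suc)
import Data.List.Base as List
import Data.List.Extrema as Extrema
open import Data.Nat.Base using (ℕ; suc)
open import Data.Product.Base using (∃; _×_)
open import Data.Sign.Base using (Sign)
import Data.Vec.Base as Vec
open import Function.Base using (_∘_)
open import Relation.Binary.Bundles using (StrictTotalOrder; DecTotalOrder)
open import Relation.Binary.Construct.Closure.ReflexiveTransitive using (Star)
open import Relation.Binary.Core using (Rel)
open import Relation.Binary.Definitions
  using (Decidable; Irreflexive; Symmetric)
open import Relation.Binary.PropositionalEquality.Core using (_≡_; refl)
import Relation.Binary.Properties.StrictTotalOrder as StrictTotalOrderProperties
open import Relation.Binary.Structures using (IsStrictTotalOrder)
open import Relation.Nullary using (¬_; Dec; yes; no)
open import Relation.Unary using (Pred)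

-- The real numbers, given by the classical axioms of a Dedekind-complete
-- totally ordered field.  These determine ℝ up to isomorphism in classical
-- mathematics; trichotomy and least upper bounds of arbitrary predicates are
-- meant classically.  As usual the inverse is a total function whose value at
-- 0# is not specified.
record RealField (c ℓ₁ ℓ₂ : Level) : Set (lsuc (c ⊔ ℓ₁ ⊔ ℓ₂)) where
  infix  4 _<_ _>_ _≥_
  infix  8 _⁻¹
  infixl 7 _/_

  field
    commutativeRing : CommutativeRing c ℓ₁

  open CommutativeRing commutativeRing public

  field
    _<_                : Rel Carrier ℓ₂
    isStrictTotalOrder : IsStrictTotalOrder _≈_ _<_
    _⁻¹                : Carrier → Carrier

  strictTotalOrder : StrictTotalOrder c ℓ₁ ℓ₂
  strictTotalOrder = record { isStrictTotalOrder = isStrictTotalOrder }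

  decTotalOrder : DecTotalOrder c ℓ₁ (ℓ₁ ⊔ ℓ₂)
  decTotalOrder = StrictTotalOrderProperties.decTotalOrder strictTotalOrder

  open DecTotalOrder decTotalOrder public using (_≤_; totalOrder)

  _>_ : Rel Carrier ℓ₂
  x > y = y < x

  _≥_ : Rel Carrier (ℓ₁ ⊔ ℓ₂)
  x ≥ y = y ≤ x

  _/_ : Carrier → Carrier → Carrier
  x / y = x * y ⁻¹

  UpperBound : Pred Carrier (c ⊔ ℓ₁ ⊔ ℓ₂) → Pred Carrier (c ⊔ ℓ₁ ⊔ ℓ₂)
  UpperBound P b = ∀ x → P x → x ≤ b

  IsSupremum : Pred Carrier (c ⊔ ℓ₁ ⊔ ℓ₂) → Pred Carrier (c ⊔ ℓ₁ ⊔ ℓ₂)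
  IsSupremum P s = UpperBound P s × (∀ b → UpperBound P b → s ≤ b)

  field
    0≉1      : ¬ (0# ≈ 1#)
    ⁻¹-cong  : ∀ {x y} → x ≈ y → x ⁻¹ ≈ y ⁻¹
    inverseʳ : ∀ x → ¬ (x ≈ 0#) → x * x ⁻¹ ≈ 1#
    +-mono-< : ∀ {x y} z → x < y → x + z < y + z
    *-pos    : ∀ {x y} → 0# < x → 0# < y → 0# < x * y
    complete : (P : Pred Carrier (c ⊔ ℓ₁ ⊔ ℓ₂)) →
               ∃ P → ∃ (UpperBound P) → ∃ (IsSupremum P)

-- A finite simple graph with vertex set Fin n.
record Graph (n : ℕ) : Set₁ where
  infix 4 _∼_ _∼?_
  field
    _∼_      : Rel (Fin n) 0ℓ
    _∼?_     : Decidable _∼_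
    ∼-sym    : Symmetric _∼_
    ∼-irrefl : Irreflexive _≡_ _∼_

  degree : Fin n → ℕ
  degree x = Vec.count (x ∼?_) (Vec.allFin n)

  Connected : Set
  Connected = ∀ x y → Star _∼_ x y

-- σ is defined on edges only.  σ-sym makes it a function of the unordered
-- pair {x , y}; applied twice, it also makes σ independent of the proof of
-- adjacency.
record Signing {n : ℕ} (G : Graph n) : Set where
  open Graph G
  field
    σ     : ∀ {x y} → x ∼ y → Sign
    σ-sym : ∀ {x y} (p : x ∼ y) (q : y ∼ x) → σ p ≡ σ q

allPositive : ∀ {n} (G : Graph n) → Signing G
allPositive G = record { σ = λ _ → Sign.+ ; σ-sym = λ _ _ → refl }

module SignedCalculus {c ℓ₁ ℓ₂} (ℝ : RealField c ℓ₁ ℓ₂) where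

  open RealField ℝ hiding (zero)
  open RawMonoidDefs +-rawMonoid using (sum) renaming (_×_ to _·_)

  infix 9 _² 1/_

  2# 4# : Carrier
  2# = 1# + 1#
  4# = 2# + 2#

  _² : Carrier → Carrier
  x ² = x * x

  max : ∀ {n} → (Fin (suc n) → Carrier) → Carrier
  max g = Extrema.max totalOrder (g zero) (List.tabulate (g ∘ suc))

  ⟦_⟧ : Sign → Carrier
  ⟦ Sign.+ ⟧ = 1#
  ⟦ Sign.- ⟧ = - 1#

  -- The interval (0 , ∞].
  data Dimension : Set (c ⊔ ℓ₂) where
    finite : (N : Carrier) → 0# < N → Dimension
    ∞      : Dimension

  1/_ : Dimension → Carrier
  1/ finite N _ = N ⁻¹
  1/ ∞          = 0#

  whenever : ∀ {p} {P : Set p} → Dec P → (P → Carrier) → Carrier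
  whenever (yes p) t = t p
  whenever (no  _) t = 0#

  module _ {n : ℕ} {G : Graph n} where

    open Graph G

    ∑∼ : (x : Fin n) → (∀ y → x ∼ y → Carrier) → Carrier
    ∑∼ x t = sum (λ y → whenever (x ∼? y) (t y))

    -- At an isolated vertex the sum is empty, so the value is 0# whatever
    -- 0# ⁻¹ is.
    Δ[_] : Signing G → (Fin n → Carrier) → Fin n → Carrier
    Δ[ s ] f x =
      (degree x · 1#) ⁻¹ * ∑∼ x (λ y p → ⟦ Signing.σ s p ⟧ * f y - f x)

    Δ : (Fin n → Carrier) → Fin n → Carrier
    Δ = Δ[ allPositive G ]

    module _ (s : Signing G) where

      Γ : (f g : Fin n → Carrier) → Fin n → Carrier
      Γ f g x =
        2# ⁻¹ * (Δ (λ y → f y * g y) x - g x * Δ[ s ] f x - f x * Δ[ s ] g x)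

      Γ₂ : (f g : Fin n → Carrier) → Fin n → Carrier
      Γ₂ f g x =
        2# ⁻¹ * (Δ (Γ f g) x - Γ g (Δ[ s ] f) x - Γ f (Δ[ s ] g) x)

      ∣∇_∣² : (Fin n → Carrier) → Fin n → Carrier
      ∣∇ f ∣² x = 2# * Γ f f x

      CD : Carrier → Dimension → Set (c ⊔ ℓ₁ ⊔ ℓ₂)
      CD K N = ∀ f x → Γ₂ f f x ≥ 1/ N * (Δ[ s ] f x) ² + K * Γ f f x

      record IsEigenfunction (μ : Carrier) (f : Fin n → Carrier) : Set ℓ₁ where
        field
          nonzero  : ∃ λ x → ¬ (f x ≈ 0#)
          equation : ∀ x → - Δ[ s ] f x ≈ μ * f x

{-# OPTIONS --safe #-}

-- With F = |∇f|² + αμf², the maximum principle at a vertex x₀ maximising F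
-- gives ΔF(x₀) ≤ 0.  Expanding ΔF by the Bochner formula
-- ΔΓ(f) = 2Γ₂(f) − 2μΓ(f) and bounding Γ₂ by CD(K,N) yields
-- F(x₀) D ≤ P μ f(x₀)², where P / D is the fraction in the claim.  To replace
-- f(x₀)² by max f² one needs Pμ ≥ 0, which follows from F(x₀) > 0, hence from
-- α > 0.  The latter holds because 0 < μ and K ≤ μ: the first is the maximum
-- principle for f², the second the maximum principle for Γ(f), since K > μ
-- would force Γ(f) = 0 and therefore Δσ f = 0.

module Submission where

open import Defs
open import Algebra.Bundles using (CommutativeRing)
open import Data.Fin.Base using (Fin; zero; suc)
open import Data.Nat.Base using (ℕ; suc)
open import Relation.Nullary using (¬_; Dec; yes; no; contradiction)

import Algebra.Properties.Ring as RingProperties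
import Algebra.Properties.Semiring.Mult.TCOptimised as Mult
import Algebra.Properties.Semiring.Sum as SemiringSum
import Algebra.Solver.Ring as RingSolver
open import Algebra.Solver.Ring.AlmostCommutativeRing
  using (fromCommutativeRing; _-Raw-AlmostCommutative⟶_)
open import Data.Integer.Base as ℤ using (ℤ; +_; -[1+_]; _⊖_)
import Data.Integer.Properties as ℤ
import Data.List.Base as List
import Data.List.Extrema as Extrema
import Data.List.Relation.Unary.All.Properties as All
open import Data.Maybe.Base using (Maybe)
import Data.Maybe.Base as Maybe
import Data.Nat.Base as ℕ
open import Data.Product.Base using (∃; _,_; proj₁; proj₂)
open import Data.Sign.Base using (Sign)
open import Data.Sum.Base using (_⊎_; inj₁; inj₂)
import Data.Vec.Base as Vec
open import Data.Vec.Functional using (replicate)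
open import Function.Base using (_∘_)
open import Relation.Binary.Bundles using (DecTotalOrder)
open import Relation.Binary.Consequences using (dec⇒weaklyDec)
open import Relation.Binary.Definitions using (tri<; tri≈; tri>)
open import Relation.Binary.PropositionalEquality.Core as ≡ using (_≡_)
import Relation.Binary.Reasoning.Setoid as SetoidReasoning
open import Relation.Binary.Structures using (IsStrictTotalOrder)
open import Relation.Unary using (Pred)
import Relation.Unary as Unary

-- Integer coefficients let the solver cancel terms in a ring whose own
-- equality does not compute.
module IntegerCoefficients {c ℓ} (R : CommutativeRing c ℓ) where

  open CommutativeRing R
  open RingProperties ring
  open Mult semiring
  open SetoidReasoning setoid

  fromℤ : ℤ → Carrier
  fromℤ (+ n)    = n × 1#
  fromℤ -[1+ n ] = - (suc n × 1#)

  fromℤ-neg : ∀ i → fromℤ (ℤ.- i) ≈ - fromℤ i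
  fromℤ-neg (+ 0)      = sym -0#≈0#
  fromℤ-neg (+ suc n)  = refl
  fromℤ-neg -[1+ n ]   = sym (-‿involutive _)

  -- Induction strips one successor from both arguments; the step restores it by inserting
  -- `1# - 1#`.
  fromℤ-⊖ : ∀ m n → fromℤ (m ⊖ n) ≈ m × 1# - n × 1#
  fromℤ-⊖ m 0 = begin
    m × 1#        ≈⟨ +-identityʳ _ ⟨
    m × 1# + 0#   ≈⟨ +-congˡ -0#≈0# ⟨
    m × 1# - 0#   ∎
  fromℤ-⊖ 0 (suc n) = sym (+-identityˡ _)
  fromℤ-⊖ (suc m) (suc n) = begin
    fromℤ (suc m ⊖ suc n)               ≡⟨ ≡.cong fromℤ (ℤ.[1+m]⊖[1+n]≡m⊖n m n) ⟩
    fromℤ (m ⊖ n)                       ≈⟨ fromℤ-⊖ m n ⟩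
    m × 1# - n × 1#                     ≈⟨ +-congʳ (+-identityʳ _) ⟨
    (m × 1# + 0#) - n × 1#              ≈⟨ +-congʳ (+-congˡ (-‿inverseʳ 1#)) ⟨
    (m × 1# + (1# - 1#)) - n × 1#       ≈⟨ +-congʳ (+-assoc _ _ _) ⟨
    ((m × 1# + 1#) - 1#) - n × 1#       ≈⟨ +-assoc _ _ _ ⟩
    (m × 1# + 1#) + (- 1# - n × 1#)     ≈⟨ +-cong (+-comm _ _) (-‿+-comm _ _) ⟩
    (1# + m × 1#) - (1# + n × 1#)       ≈⟨ +-cong (1+× m 1#) (-‿cong (1+× n 1#)) ⟨
    suc m × 1# - suc n × 1#             ∎

  fromℤ-+ : ∀ i j → fromℤ (i ℤ.+ j) ≈ fromℤ i + fromℤ j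
  fromℤ-+ (+ m)    (+ n)    = ×-homo-+ 1# m n
  fromℤ-+ (+ m)    -[1+ n ] = fromℤ-⊖ m (suc n)
  fromℤ-+ -[1+ m ] (+ n)    = trans (fromℤ-⊖ n (suc m)) (+-comm _ _)
  fromℤ-+ -[1+ m ] -[1+ n ] = begin
    fromℤ (-[1+ m ] ℤ.+ -[1+ n ])           ≡⟨ ≡.cong fromℤ (ℤ.neg-distrib-+ (+ suc m) (+ suc n)) ⟨
    fromℤ (ℤ.- (+ suc m ℤ.+ + suc n))       ≈⟨ -‿cong (×-homo-+ 1# (suc m) (suc n)) ⟩
    - (suc m × 1# + suc n × 1#)             ≈⟨ -‿+-comm _ _ ⟨
    - (suc m × 1#) - suc n × 1#             ∎

  fromℤ-*-pos : ∀ m j → fromℤ (+ m ℤ.* j) ≈ fromℤ (+ m) * fromℤ j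
  fromℤ-*-pos m (+ n) = begin
    fromℤ (+ m ℤ.* + n)   ≡⟨ ≡.cong fromℤ (ℤ.pos-* m n) ⟨
    (m ℕ.* n) × 1#        ≈⟨ ×1-homo-* m n ⟩
    m × 1# * n × 1#       ∎
  fromℤ-*-pos m -[1+ n ] = begin
    fromℤ (+ m ℤ.* -[1+ n ])       ≡⟨ ≡.cong fromℤ (ℤ.neg-distribʳ-* (+ m) (+ suc n)) ⟨
    fromℤ (ℤ.- (+ m ℤ.* + suc n))  ≈⟨ fromℤ-neg (+ m ℤ.* + suc n) ⟩
    - fromℤ (+ m ℤ.* + suc n)      ≈⟨ -‿cong (fromℤ-*-pos m (+ suc n)) ⟩
    - (m × 1# * suc n × 1#)        ≈⟨ -‿distribʳ-* _ _ ⟩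
    m × 1# * - (suc n × 1#)        ∎

  fromℤ-* : ∀ i j → fromℤ (i ℤ.* j) ≈ fromℤ i * fromℤ j
  fromℤ-* (+ m)    j = fromℤ-*-pos m j
  fromℤ-* -[1+ m ] j = begin
    fromℤ (-[1+ m ] ℤ.* j)         ≡⟨ ≡.cong fromℤ (ℤ.neg-distribˡ-* (+ suc m) j) ⟨
    fromℤ (ℤ.- (+ suc m ℤ.* j))    ≈⟨ fromℤ-neg (+ suc m ℤ.* j) ⟩
    - fromℤ (+ suc m ℤ.* j)        ≈⟨ -‿cong (fromℤ-*-pos (suc m) j) ⟩
    - (suc m × 1# * fromℤ j)       ≈⟨ -‿distribˡ-* _ _ ⟩
    - (suc m × 1#) * fromℤ j       ∎

  morphism : ℤ.+-*-rawRing -Raw-AlmostCommutative⟶ fromCommutativeRing R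
  morphism = record
    { ⟦_⟧    = fromℤ
    ; +-homo = fromℤ-+
    ; *-homo = fromℤ-*
    ; -‿homo = fromℤ-neg
    ; 0-homo = refl
    ; 1-homo = refl
    }

  -- Distinct integers may still have equal images in a general ring, so a failed integer comparison
  -- yields `nothing` and not a refutation.
  fromℤ≟ : ∀ i j → Maybe (fromℤ i ≈ fromℤ j)
  fromℤ≟ i j = Maybe.map (λ { ≡.refl → refl }) (dec⇒weaklyDec ℤ._≟_ i j)

  open RingSolver ℤ.+-*-rawRing (fromCommutativeRing R) morphism fromℤ≟ public
    using (solve; _:=_; _:+_; _:*_; _:-_; :-_; con; Polynomial)

  :0 :1 :2 : ∀ {m} → Polynomial m
  :0 = con (+ 0)
  :1 = con (+ 1)
  :2 = :1 :+ :1

-- Order arithmetic in the real field, and maxima over finite sets.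

module OrderedField {c ℓ₁ ℓ₂} (ℝ : RealField c ℓ₁ ℓ₂) where

  open RealField ℝ hiding (zero)
  open SignedCalculus ℝ using (_²; 2#; max)
  open IntegerCoefficients commutativeRing
  open IsStrictTotalOrder isStrictTotalOrder public
    using (compare; <-respʳ-≈; <-respˡ-≈; irrefl)
    renaming (trans to <-trans)
  open DecTotalOrder decTotalOrder public
    using (≤-respʳ-≈; ≤-respˡ-≈)
    renaming (refl to ≤-refl; reflexive to ≤-reflexive; trans to ≤-trans; total to ≤-total)

  +-monoˡ-≤ : ∀ {x y} z → x ≤ y → x + z ≤ y + z
  +-monoˡ-≤ z (inj₁ x<y) = inj₁ (+-mono-< z x<y)
  +-monoˡ-≤ z (inj₂ x≈y) = inj₂ (+-congʳ x≈y)

  x≤y⇒0≤y-x : ∀ {x y} → x ≤ y → 0# ≤ y - x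
  x≤y⇒0≤y-x {x} x≤y = ≤-respˡ-≈ (-‿inverseʳ x) (+-monoˡ-≤ (- x) x≤y)

  x<y⇒0<y-x : ∀ {x y} → x < y → 0# < y - x
  x<y⇒0<y-x {x} x<y = <-respˡ-≈ (-‿inverseʳ x) (+-mono-< (- x) x<y)

  -- The standard route to an inequality below: a visibly nonnegative `d` is exhibited, and the ring
  -- solver identifies it with the difference.
  ≤-from-difference : ∀ {x y d} → 0# ≤ d → d ≈ y - x → x ≤ y
  ≤-from-difference {x} {y} 0≤d d≈y-x =
    ≤-respˡ-≈ (+-identityˡ x)
      (≤-respʳ-≈ (trans (+-congʳ d≈y-x) (solve 2 (λ x y → y :- x :+ x := y) refl x y))
        (+-monoˡ-≤ x 0≤d))

  <≤⇒< : ∀ {x y z} → x < y → y ≤ z → x < z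
  <≤⇒< x<y (inj₁ y<z) = <-trans x<y y<z
  <≤⇒< x<y (inj₂ y≈z) = <-respʳ-≈ y≈z x<y

  ≮⇒≥ : ∀ {x y} → ¬ (x < y) → y ≤ x
  ≮⇒≥ {x} {y} x≮y with compare x y
  ... | tri< x<y _ _ = contradiction x<y x≮y
  ... | tri≈ _ x≈y _ = inj₂ (sym x≈y)
  ... | tri> _ _ y<x = inj₁ y<x

  <⇒≱ : ∀ {x y} → x < y → ¬ (y ≤ x)
  <⇒≱ x<y y≤x = irrefl refl (<≤⇒< x<y y≤x)

  +-nonneg : ∀ {x y} → 0# ≤ x → 0# ≤ y → 0# ≤ x + y
  +-nonneg {x} {y} 0≤x 0≤y =
    ≤-trans 0≤y (≤-respˡ-≈ (+-identityˡ y) (+-monoˡ-≤ y 0≤x))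

  +-nonneg-pos : ∀ {x y} → 0# ≤ x → 0# < y → 0# < x + y
  +-nonneg-pos {x} {y} 0≤x 0<y =
    <≤⇒< 0<y (≤-respˡ-≈ (+-identityˡ y) (+-monoˡ-≤ y 0≤x))

  *-nonneg : ∀ {x y} → 0# ≤ x → 0# ≤ y → 0# ≤ x * y
  *-nonneg (inj₁ 0<x) (inj₁ 0<y) = inj₁ (*-pos 0<x 0<y)
  *-nonneg (inj₂ 0≈x) _          = inj₂ (sym (trans (*-congʳ (sym 0≈x)) (zeroˡ _)))
  *-nonneg (inj₁ _)   (inj₂ 0≈y) = inj₂ (sym (trans (*-congˡ (sym 0≈y)) (zeroʳ _)))

  x<0⇒0<-x : ∀ {x} → x < 0# → 0# < - x
  x<0⇒0<-x {x} x<0 = <-respʳ-≈ (+-identityˡ (- x)) (x<y⇒0<y-x x<0)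

  ²-pos : ∀ {x} → ¬ (x ≈ 0#) → 0# < x ²
  ²-pos {x} x≉0 with compare 0# x
  ... | tri< 0<x _ _ = *-pos 0<x 0<x
  ... | tri≈ _ 0≈x _ = contradiction (sym 0≈x) x≉0
  ... | tri> _ _ x<0 =
    <-respʳ-≈ (solve 1 (λ x → :- x :* :- x := x :* x) refl x) (*-pos (x<0⇒0<-x x<0) (x<0⇒0<-x x<0))

  ²-nonneg : ∀ x → 0# ≤ x ²
  ²-nonneg x with compare 0# x
  ... | tri< 0<x _ _ = inj₁ (*-pos 0<x 0<x)
  ... | tri≈ _ 0≈x _ = inj₂ (sym (trans (*-congʳ (sym 0≈x)) (zeroˡ x)))
  ... | tri> _ x≉0 x<0 = inj₁ (²-pos (λ x≈0 → x≉0 (sym x≈0)))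

  ²≤0⇒≈0 : ∀ {x} → x ² ≤ 0# → x ≈ 0#
  ²≤0⇒≈0 {x} x²≤0 with compare x 0#
  ... | tri< _ x≉0 _ = contradiction x²≤0 (<⇒≱ (²-pos x≉0))
  ... | tri≈ _ x≈0 _ = x≈0
  ... | tri> _ x≉0 _ = contradiction x²≤0 (<⇒≱ (²-pos x≉0))

  0<1 : 0# < 1#
  0<1 = <-respʳ-≈ (*-identityˡ 1#) (²-pos (0≉1 ∘ sym))

  0<2 : 0# < 2#
  0<2 = +-nonneg-pos (inj₁ 0<1) 0<1

  pos⇒≉0 : ∀ {x} → 0# < x → ¬ (x ≈ 0#)
  pos⇒≉0 0<x x≈0 = irrefl (sym x≈0) 0<x

  *-cancelˡ-nonneg : ∀ {x y} → 0# < x → 0# ≤ x * y → 0# ≤ y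
  *-cancelˡ-nonneg {x} {y} 0<x 0≤xy = ≮⇒≥ λ y<0 →
    <⇒≱ (*-pos 0<x (x<0⇒0<-x y<0))
      (≤-from-difference 0≤xy
        (solve 2 (λ x y → x :* y := :0 :- x :* :- y) refl x y))

  *-cancelʳ-nonneg : ∀ {x y} → 0# < y → 0# ≤ x * y → 0# ≤ x
  *-cancelʳ-nonneg {x} {y} 0<y 0≤xy = *-cancelˡ-nonneg 0<y (≤-respʳ-≈ (*-comm x y) 0≤xy)

  *-cancelˡ-≤ : ∀ {x y z} → 0# < x → x * y ≤ x * z → y ≤ z
  *-cancelˡ-≤ {x} {y} {z} 0<x xy≤xz =
    ≤-from-difference
      (*-cancelˡ-nonneg 0<x
        (≤-respʳ-≈ (solve 3 (λ x y z → x :* z :- x :* y := x :* (z :- y)) refl x y z)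
          (x≤y⇒0≤y-x xy≤xz)))
      refl

  *-cancelˡ-≈0 : ∀ {x y} → ¬ (x ≈ 0#) → x * y ≈ 0# → y ≈ 0#
  *-cancelˡ-≈0 {x} {y} x≉0 xy≈0 = begin
    y                ≈⟨ *-identityˡ y ⟨
    1# * y           ≈⟨ *-congʳ (inverseʳ x x≉0) ⟨
    x * x ⁻¹ * y     ≈⟨ solve 3 (λ x x⁻¹ y → x :* x⁻¹ :* y := x⁻¹ :* (x :* y)) refl x (x ⁻¹) y ⟩
    x ⁻¹ * (x * y)   ≈⟨ *-congˡ xy≈0 ⟩
    x ⁻¹ * 0#        ≈⟨ zeroʳ _ ⟩
    0#               ∎
    where open SetoidReasoning setoid

  *-monoˡ-≤ : ∀ {x y z} → 0# ≤ x → y ≤ z → x * y ≤ x * z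
  *-monoˡ-≤ {x} {y} {z} 0≤x y≤z =
    ≤-from-difference (*-nonneg 0≤x (x≤y⇒0≤y-x y≤z))
      (solve 3 (λ x y z → x :* (z :- y) := x :* z :- x :* y) refl x y z)

  ⁻¹-pos : ∀ {x} → 0# < x → 0# < x ⁻¹
  ⁻¹-pos {x} 0<x with compare 0# (x ⁻¹)
  ... | tri< 0<x⁻¹ _ _ = 0<x⁻¹
  ... | tri≈ _ 0≈x⁻¹ _ = contradiction
    (trans (sym (trans (*-congˡ (sym 0≈x⁻¹)) (zeroʳ x))) (inverseʳ x (pos⇒≉0 0<x))) 0≉1
  ... | tri> _ _ x⁻¹<0 = contradiction
    (*-cancelˡ-nonneg 0<x (inj₁ (<-respʳ-≈ (sym (inverseʳ x (pos⇒≉0 0<x))) 0<1)))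
    (<⇒≱ x⁻¹<0)

  -- The maximum principle needs a point where the maximum is attained, whereas `max` supplies only
  -- its value.
  ∃-argmax : ∀ {n} (g : Fin (suc n) → Carrier) → ∃ λ m → ∀ y → g y ≤ g m
  ∃-argmax {0} g = zero , λ { zero → ≤-refl }
  ∃-argmax {suc n} g with ∃-argmax (g ∘ suc)
  ... | m , g≤gm with ≤-total (g zero) (g (suc m))
  ...   | inj₁ g0≤gm = suc m , λ { zero → g0≤gm ; (suc y) → g≤gm y }
  ...   | inj₂ gm≤g0 = zero , λ { zero → ≤-refl ; (suc y) → ≤-trans (g≤gm y) gm≤g0 }

  g≤max : ∀ {n} (g : Fin (suc n) → Carrier) y → g y ≤ max g
  g≤max g zero    = Extrema.⊥≤max totalOrder (g zero) (List.tabulate (g ∘ suc))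
  g≤max g (suc y) = All.tabulate⁻ (Extrema.xs≤max totalOrder (g zero) (List.tabulate (g ∘ suc))) y

-- Stated for an arbitrary tabulation `h` because the tail of `allFin` tabulates `suc` and no longer
-- the identity.
count≡0⇒∄ : ∀ {a p} {A : Set a} {P : Pred A p} (P? : Unary.Decidable P) {n} (h : Fin n → A) →
            Vec.count P? (Vec.tabulate h) ≡ 0 → ∀ i → ¬ P (h i)
count≡0⇒∄ P? {suc n} h count≡0 i p with P? (h zero) | i
... | no ¬p | zero   = ¬p p
... | no _  | suc i′ = count≡0⇒∄ P? (h ∘ suc) count≡0 i′ p

-- Neighbour sums, neighbour means and the signed Laplacian.

module SignedGraph {c ℓ₁ ℓ₂} (ℝ : RealField c ℓ₁ ℓ₂) {n : ℕ} (G : Graph n) where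

  open RealField ℝ hiding (zero)
  open SignedCalculus ℝ hiding (∑∼; Δ)
  open IntegerCoefficients commutativeRing
  open OrderedField ℝ
  open SemiringSum semiring using (sum; sum-cong-≋; sum-replicate-zero; ∑-distrib-+; *-distribˡ-sum)
  open import Algebra.Definitions.RawMonoid +-rawMonoid using () renaming (_×_ to _·_)
  open Graph G
  open SetoidReasoning setoid

  private
    ∑∼ : (x : Fin n) → (∀ y → x ∼ y → Carrier) → Carrier
    ∑∼ = SignedCalculus.∑∼ ℝ {G = G}

    Δ : (Fin n → Carrier) → Fin n → Carrier
    Δ = SignedCalculus.Δ ℝ {G = G}

  sum-nonneg : ∀ {n} (h : Fin n → Carrier) → (∀ i → 0# ≤ h i) → 0# ≤ sum h
  sum-nonneg {0}     h 0≤h = ≤-refl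
  sum-nonneg {suc n} h 0≤h = +-nonneg (0≤h zero) (sum-nonneg (h ∘ suc) (0≤h ∘ suc))

  term≤sum : ∀ {n} (h : Fin n → Carrier) → (∀ i → 0# ≤ h i) → ∀ i → h i ≤ sum h
  term≤sum {suc n} h 0≤h zero = ≤-from-difference
    (sum-nonneg (h ∘ suc) (0≤h ∘ suc))
    (solve 2 (λ a b → b := a :+ b :- a) refl (h zero) (sum (h ∘ suc)))
  term≤sum {suc n} h 0≤h (suc i) = ≤-trans (term≤sum (h ∘ suc) (0≤h ∘ suc) i)
    (≤-from-difference (0≤h zero)
      (solve 2 (λ a b → a := a :+ b :- b) refl (h zero) (sum (h ∘ suc))))

  -- Extension by zero off the neighbourhood of `x` turns a neighbour sum into an ordinary sum over
  -- `Fin n`.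
  restrict : ∀ x → (∀ y → x ∼ y → Carrier) → Fin n → Carrier
  restrict x t y = whenever (x ∼? y) (t y)

  -- The helper `term` receives the adjacency decision as an argument, so that matching on it makes
  -- `whenever` reduce; the same device recurs below.
  ∑∼-cong : ∀ x {t u : ∀ y → x ∼ y → Carrier} → (∀ y p → t y p ≈ u y p) → ∑∼ x t ≈ ∑∼ x u
  ∑∼-cong x {t} {u} t≈u = sum-cong-≋ λ y → term y (x ∼? y)
    where
    term : ∀ y (d : Dec (x ∼ y)) → whenever d (t y) ≈ whenever d (u y)
    term y (yes p) = t≈u y p
    term y (no _)  = refl

  ∑∼-+ : ∀ x (t u : ∀ y → x ∼ y → Carrier) →
         ∑∼ x (λ y p → t y p + u y p) ≈ ∑∼ x t + ∑∼ x u
  ∑∼-+ x t u = trans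
    (sum-cong-≋ {x = restrict x (λ y p → t y p + u y p)} λ y → term y (x ∼? y))
    (∑-distrib-+ (restrict x t) (restrict x u))
    where
    term : ∀ y (d : Dec (x ∼ y)) →
           whenever d (λ p → t y p + u y p) ≈ whenever d (t y) + whenever d (u y)
    term y (yes p) = refl
    term y (no _)  = sym (+-identityˡ 0#)

  ∑∼-* : ∀ x a (t : ∀ y → x ∼ y → Carrier) → ∑∼ x (λ y p → a * t y p) ≈ a * ∑∼ x t
  ∑∼-* x a t = trans
    (sum-cong-≋ {x = restrict x (λ y p → a * t y p)} λ y → term y (x ∼? y))
    (sym (*-distribˡ-sum a (restrict x t)))
    where
    term : ∀ y (d : Dec (x ∼ y)) → whenever d (λ p → a * t y p) ≈ a * whenever d (t y)
    term y (yes p) = refl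
    term y (no _)  = sym (zeroʳ a)

  whenever-nonneg : ∀ {p} {P : Set p} (d : Dec P) {t : P → Carrier} →
                    (∀ p → 0# ≤ t p) → 0# ≤ whenever d t
  whenever-nonneg (yes p) 0≤t = 0≤t p
  whenever-nonneg (no _)  _   = ≤-refl

  ∑∼-nonneg : ∀ x {t : ∀ y → x ∼ y → Carrier} → (∀ y p → 0# ≤ t y p) → 0# ≤ ∑∼ x t
  ∑∼-nonneg x {t} 0≤t = sum-nonneg (restrict x t) λ y → whenever-nonneg (x ∼? y) (0≤t y)

  restrict≤∑∼ : ∀ x {t : ∀ y → x ∼ y → Carrier} → (∀ y p → 0# ≤ t y p) →
                ∀ y → restrict x t y ≤ ∑∼ x t
  restrict≤∑∼ x {t} 0≤t = term≤sum (restrict x t) λ y → whenever-nonneg (x ∼? y) (0≤t y)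

  -- Every `Δ[ s ] f x` unfolds to such a mean, and the squared gradient is shown to equal one, so
  -- linearity and positivity are settled here once.
  mean : ∀ x → (∀ y → x ∼ y → Carrier) → Carrier
  mean x t = (degree x · 1#) ⁻¹ * ∑∼ x t

  mean-cong : ∀ x {t u : ∀ y → x ∼ y → Carrier} → (∀ y p → t y p ≈ u y p) → mean x t ≈ mean x u
  mean-cong x t≈u = *-congˡ (∑∼-cong x t≈u)

  mean-linear : ∀ x a b (t u : ∀ y → x ∼ y → Carrier) →
                mean x (λ y p → a * t y p + b * u y p) ≈ a * mean x t + b * mean x u
  mean-linear x a b t u = begin
    d * ∑∼ x (λ y p → a * t y p + b * u y p)
      ≈⟨ *-congˡ (∑∼-+ x _ _) ⟩
    d * (∑∼ x (λ y p → a * t y p) + ∑∼ x (λ y p → b * u y p))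
      ≈⟨ *-congˡ (+-cong (∑∼-* x a t) (∑∼-* x b u)) ⟩
    d * (a * ∑∼ x t + b * ∑∼ x u)
      ≈⟨ solve 5 (λ d a b s r → d :* (a :* s :+ b :* r) := a :* (d :* s) :+ b :* (d :* r))
           refl d a b (∑∼ x t) (∑∼ x u) ⟩
    a * mean x t + b * mean x u ∎
    where d = (degree x · 1#) ⁻¹

  suc·1-pos : ∀ k → 0# < suc k · 1#
  suc·1-pos 0       = <-respʳ-≈ (sym (+-identityʳ 1#)) 0<1
  suc·1-pos (suc k) = +-nonneg-pos (inj₁ 0<1) (suc·1-pos k)

  -- The inverse of `0#` has no specified sign, so positivity of the weight is available only at
  -- vertices with neighbours; elsewhere the empty sum decides.
  isolated-or-degree-pos : ∀ x → (∀ y → ¬ x ∼ y) ⊎ 0# < degree x · 1#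
  isolated-or-degree-pos x with degree x in eq
  ... | 0     = inj₁ (count≡0⇒∄ (x ∼?_) (λ y → y) eq)
  ... | suc k = inj₂ (suc·1-pos k)

  mean-vanishing : ∀ x (t : ∀ y → x ∼ y → Carrier) → (∀ y → restrict x t y ≈ 0#) → mean x t ≈ 0#
  mean-vanishing x t t≈0 = begin
    mean x t                                    ≈⟨ *-congˡ (sum-cong-≋ t≈0) ⟩
    (degree x · 1#) ⁻¹ * sum (replicate n 0#)   ≈⟨ *-congˡ (sum-replicate-zero n) ⟩
    (degree x · 1#) ⁻¹ * 0#                     ≈⟨ zeroʳ _ ⟩
    0#                                          ∎

  mean-isolated : ∀ x (t : ∀ y → x ∼ y → Carrier) → (∀ y → ¬ x ∼ y) → mean x t ≈ 0#
  mean-isolated x t isolated = mean-vanishing x t λ y → term y (x ∼? y)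
    where
    term : ∀ y (d : Dec (x ∼ y)) → whenever d (t y) ≈ 0#
    term y (yes p) = contradiction p (isolated y)
    term y (no _)  = refl

  mean-nonneg : ∀ x {t : ∀ y → x ∼ y → Carrier} → (∀ y p → 0# ≤ t y p) → 0# ≤ mean x t
  mean-nonneg x {t} 0≤t with isolated-or-degree-pos x
  ... | inj₁ isolated = ≤-reflexive (sym (mean-isolated x t isolated))
  ... | inj₂ 0<d      = *-nonneg (inj₁ (⁻¹-pos 0<d)) (∑∼-nonneg x 0≤t)

  -- Each square is bounded by the sum of all of them, which is at most zero, so every single
  -- `t y p` vanishes.
  mean-²≤0⇒mean≈0 : ∀ x (t : ∀ y → x ∼ y → Carrier) → mean x (λ y p → t y p ²) ≤ 0# → mean x t ≈ 0#
  mean-²≤0⇒mean≈0 x t mean≤0 with isolated-or-degree-pos x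
  ... | inj₁ isolated = mean-isolated x t isolated
  ... | inj₂ 0<d      = mean-vanishing x t λ y →
    term y (x ∼? y) (≤-trans (restrict≤∑∼ x (λ z p → ²-nonneg (t z p)) y) ∑≤0)
    where
    ∑≤0 : ∑∼ x (λ y p → t y p ²) ≤ 0#
    ∑≤0 = *-cancelˡ-≤ (⁻¹-pos 0<d) (≤-respʳ-≈ (sym (zeroʳ _)) mean≤0)
    term : ∀ y (d : Dec (x ∼ y)) → whenever d (λ p → t y p ²) ≤ 0# → whenever d (t y) ≈ 0#
    term y (yes p) t²≤0 = ²≤0⇒≈0 t²≤0
    term y (no _)  _    = refl

  -- Linearity of the signed Laplacian and the maximum principle.

  module _ (s : Signing G) where

    open Signing s

    Δ-cong : ∀ {f g : Fin n → Carrier} → (∀ y → f y ≈ g y) → ∀ x → Δ[ s ] f x ≈ Δ[ s ] g x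
    Δ-cong f≈g x = mean-cong x λ y p → +-cong (*-congˡ (f≈g y)) (-‿cong (f≈g x))

    Δ-linear : ∀ a b (f g : Fin n → Carrier) x →
               Δ[ s ] (λ y → a * f y + b * g y) x ≈ a * Δ[ s ] f x + b * Δ[ s ] g x
    Δ-linear a b f g x = trans
      (mean-cong x λ y p →
        solve 7 (λ a b σ fy gy fx gx →
            σ :* (a :* fy :+ b :* gy) :- (a :* fx :+ b :* gx)
          := a :* (σ :* fy :- fx) :+ b :* (σ :* gy :- gx))
          refl a b ⟦ σ p ⟧ (f y) (g y) (f x) (g x))
      (mean-linear x a b _ _)

    Δ-* : ∀ a (f : Fin n → Carrier) x → Δ[ s ] (λ y → a * f y) x ≈ a * Δ[ s ] f x
    Δ-* a f x = begin
      Δ[ s ] (λ y → a * f y) x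
        ≈⟨ Δ-cong (λ y → solve 2 (λ a f → a :* f := a :* f :+ :0 :* f) refl a (f y)) x ⟩
      Δ[ s ] (λ y → a * f y + 0# * f y) x
        ≈⟨ Δ-linear a 0# f f x ⟩
      a * Δ[ s ] f x + 0# * Δ[ s ] f x
        ≈⟨ solve 2 (λ a f → a :* f :+ :0 :* f := a :* f) refl a (Δ[ s ] f x) ⟩
      a * Δ[ s ] f x ∎

  -- The discrete maximum principle: `- Δ g x` is a mean of the nonnegative differences `g x - g y`.
  Δ-at-maximum : ∀ (g : Fin n → Carrier) x → (∀ y → g y ≤ g x) → Δ g x ≤ 0#
  Δ-at-maximum g x g≤gx = ≤-from-difference
    (mean-nonneg x λ y _ → x≤y⇒0≤y-x (g≤gx y))
    (begin
      mean x (λ y _ → g x - g y)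
        -- The summand `0# * 0#` only provides the two-term shape that `mean-linear` expects.
        ≈⟨ mean-cong x (λ y _ → solve 2 (λ gx gy →
             gx :- gy := :- :1 :* (:1 :* gy :- gx) :+ :0 :* :0) refl (g x) (g y)) ⟩
      mean x (λ y _ → - 1# * (1# * g y - g x) + 0# * 0#)
        ≈⟨ mean-linear x (- 1#) 0# _ _ ⟩
      - 1# * Δ g x + 0# * mean x (λ _ _ → 0#)
        ≈⟨ solve 2 (λ d m → :- :1 :* d :+ :0 :* m := :0 :- d) refl (Δ g x) _ ⟩
      0# - Δ g x ∎)

  -- Clears the factor one half in the definitions of `Γ` and `Γ₂`.
  2*half : ∀ z → 2# * (2# ⁻¹ * z) ≈ z
  2*half z = begin
    2# * (2# ⁻¹ * z)  ≈⟨ *-assoc _ _ _ ⟨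
    2# * 2# ⁻¹ * z    ≈⟨ *-congʳ (inverseʳ 2# (pos⇒≉0 0<2)) ⟩
    1# * z            ≈⟨ *-identityˡ z ⟩
    z                 ∎

  ⟦⟧² : ∀ (e : Sign) → ⟦ e ⟧ ² ≈ 1#
  ⟦⟧² Sign.+ = *-identityˡ 1#
  ⟦⟧² Sign.- = solve 0 (:- :1 :* :- :1 := :1) refl

  -- The squared gradient as a mean of squares.

  module _ (s : Signing G) (f : Fin n → Carrier) where

    open Signing s

    -- Termwise, f(y)² - f(x)² - 2f(x)(σf(y) - f(x)) equals (σf(y) - f(x))² because σ² = 1. This is
    -- how the unsigned Laplacian of f² combines with signed terms into a square.
    ∣∇∣²-mean : ∀ x → ∣∇_∣² s f x ≈ mean x (λ y p → (⟦ σ p ⟧ * f y - f x) ²)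
    ∣∇∣²-mean x = begin
      ∣∇_∣² s f x
        ≈⟨ 2*half _ ⟩
      Δ (λ y → f y * f y) x - f x * Δ[ s ] f x - f x * Δ[ s ] f x
        ≈⟨ solve 3 (λ d f l → d :- f :* l :- f :* l := :1 :* d :+ (:- (:2 :* f)) :* l)
             refl (Δ (λ y → f y * f y) x) (f x) (Δ[ s ] f x) ⟩
      1# * Δ (λ y → f y * f y) x + - (2# * f x) * Δ[ s ] f x
        ≈⟨ mean-linear x 1# (- (2# * f x)) _ _ ⟨
      mean x (λ y p → 1# * (1# * (f y * f y) - f x * f x)
                        + - (2# * f x) * (⟦ σ p ⟧ * f y - f x))
        ≈⟨ mean-cong x square ⟩
      mean x (λ y p → (⟦ σ p ⟧ * f y - f x) ²) ∎
      where
      square : ∀ y (p : x ∼ y) →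
               1# * (1# * (f y * f y) - f x * f x) + - (2# * f x) * (⟦ σ p ⟧ * f y - f x)
                 ≈ (⟦ σ p ⟧ * f y - f x) ²
      square y p = begin
        1# * (1# * (f y * f y) - f x * f x) + - (2# * f x) * (⟦ σ p ⟧ * f y - f x)
          -- The `1#` being replaced by σ² is the sign that `allPositive` puts on the edge.
          ≈⟨ +-congʳ (*-congˡ (+-congʳ (*-congʳ (⟦⟧² (σ p))))) ⟨
        1# * (⟦ σ p ⟧ ² * (f y * f y) - f x * f x) + - (2# * f x) * (⟦ σ p ⟧ * f y - f x)
          ≈⟨ solve 3 (λ e fy fx →
                 :1 :* (e :* e :* (fy :* fy) :- fx :* fx) :+ (:- (:2 :* fx)) :* (e :* fy :- fx)
               := (e :* fy :- fx) :* (e :* fy :- fx)) refl ⟦ σ p ⟧ (f y) (f x) ⟩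
        (⟦ σ p ⟧ * f y - f x) ² ∎

    Γ-nonneg : ∀ x → 0# ≤ Γ s f f x
    Γ-nonneg x = *-cancelˡ-nonneg 0<2
      (≤-respʳ-≈ (sym (∣∇∣²-mean x)) (mean-nonneg x λ y p → ²-nonneg _))

    -- If the mean of the squares (σf(y) - f(x))² is at most zero, so is each square; the mean of
    -- the unsquared terms is the signed Laplacian.
    Γ≤0⇒Δ≈0 : ∀ x → Γ s f f x ≤ 0# → Δ[ s ] f x ≈ 0#
    Γ≤0⇒Δ≈0 x Γ≤0 = mean-²≤0⇒mean≈0 x _
      (≤-respˡ-≈ (∣∇∣²-mean x) (≤-respʳ-≈ (zeroʳ 2#) (*-monoˡ-≤ (inj₁ 0<2) Γ≤0)))

-- Eigenfunctions under the curvature condition.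

module EigenfunctionEstimate {c ℓ₁ ℓ₂} (ℝ : RealField c ℓ₁ ℓ₂) {n : ℕ} (G : Graph (suc n)) where

  open RealField ℝ hiding (zero)
  open SignedCalculus ℝ
  open IntegerCoefficients commutativeRing
  open OrderedField ℝ
  open SignedGraph ℝ G
  open RingProperties ring using (-0#≈0#; -‿involutive; -‿distribˡ-*)
  open SetoidReasoning setoid

  module _
    (s : Signing G) (K : Carrier) (N : Dimension) (cd : CD s K N)
    (μ : Carrier) (μ≉0 : ¬ (μ ≈ 0#)) (f : Fin (suc n) → Carrier) (eigen : IsEigenfunction s μ f)
    where

    open IsEigenfunction eigen

    private
      V : Set
      V = Fin (suc n)

      γ φ : V → Carrier
      γ = Γ s f f
      φ y = f y * f y

      Δ₊ : (V → Carrier) → V → Carrier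
      Δ₊ = Δ {G = G}

    1/N-nonneg : ∀ M → 0# ≤ 1/ M
    1/N-nonneg (finite M 0<M) = inj₁ (⁻¹-pos 0<M)
    1/N-nonneg ∞              = ≤-refl

    Δf≈-μf : ∀ x → Δ[ s ] f x ≈ - μ * f x
    Δf≈-μf x = begin
      Δ[ s ] f x      ≈⟨ -‿involutive _ ⟨
      - - Δ[ s ] f x  ≈⟨ -‿cong (equation x) ⟩
      - (μ * f x)     ≈⟨ -‿distribˡ-* μ (f x) ⟩
      - μ * f x       ∎

    -- The definition of `Γ` solved for Δ(f²) = 2Γ(f) + 2fΔσ f, with the eigenvalue equation
    -- inserted.
    Δf² : ∀ x → Δ₊ φ x ≈ 2# * (γ x - μ * φ x)
    Δf² x = begin
      Δ₊ φ x
        ≈⟨ solve 3 (λ d f l → d := (d :- f :* l :- f :* l) :+ :2 :* (f :* l))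
             refl (Δ₊ φ x) (f x) (Δ[ s ] f x) ⟩
      (Δ₊ φ x - f x * Δ[ s ] f x - f x * Δ[ s ] f x) + 2# * (f x * Δ[ s ] f x)
        ≈⟨ +-cong (sym (2*half _)) (*-congˡ (*-congˡ (Δf≈-μf x))) ⟩
      2# * γ x + 2# * (f x * (- μ * f x))
        ≈⟨ solve 3 (λ g f m → :2 :* g :+ :2 :* (f :* (:- m :* f)) := :2 :* (g :- m :* (f :* f)))
             refl (γ x) (f x) μ ⟩
      2# * (γ x - μ * φ x) ∎

    Γ[f,Δf] : ∀ x → Γ s f (Δ[ s ] f) x ≈ - μ * γ x
    Γ[f,Δf] x = begin
      2# ⁻¹ * (Δ₊ (λ y → f y * Δ[ s ] f y) x - Δ[ s ] f x * Δ[ s ] f x - f x * Δ[ s ] (Δ[ s ] f) x)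
        -- Only one factor of the square of `Δ[ s ] f x` is rewritten, so that `- μ` comes out of
        -- all three terms and leaves exactly `γ x`.
        ≈⟨ *-congˡ (+-cong (+-cong ΔfΔf (-‿cong (*-congʳ (Δf≈-μf x)))) (-‿cong (*-congˡ ΔΔf))) ⟩
      2# ⁻¹ * (- μ * Δ₊ φ x - - μ * f x * Δ[ s ] f x - f x * (- μ * Δ[ s ] f x))
        ≈⟨ solve 5 (λ h m d f l →
               h :* (m :* d :- m :* f :* l :- f :* (m :* l)) := m :* (h :* (d :- f :* l :- f :* l)))
             refl (2# ⁻¹) (- μ) (Δ₊ φ x) (f x) (Δ[ s ] f x) ⟩
      - μ * γ x ∎
      where
      ΔfΔf : Δ₊ (λ y → f y * Δ[ s ] f y) x ≈ - μ * Δ₊ φ x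
      ΔfΔf = trans
        (Δ-cong (allPositive G) (λ y → trans (*-congˡ (Δf≈-μf y))
          (solve 2 (λ m f → f :* (m :* f) := m :* (f :* f)) refl (- μ) (f y))) x)
        (Δ-* (allPositive G) (- μ) φ x)
      ΔΔf : Δ[ s ] (Δ[ s ] f) x ≈ - μ * Δ[ s ] f x
      ΔΔf = trans (Δ-cong s Δf≈-μf x) (Δ-* s (- μ) f x)

    -- The definition of `Γ₂` solved for ΔΓ(f); the mixed term Γ(f, Δσ f) is -μΓ(f) for an
    -- eigenfunction.
    bochner : ∀ x → Δ₊ γ x ≈ 2# * (Γ₂ s f f x - μ * γ x)
    bochner x = begin
      Δ₊ γ x
        ≈⟨ solve 2 (λ d g → d := (d :- g :- g) :+ :2 :* g) refl (Δ₊ γ x) (Γ s f (Δ[ s ] f) x) ⟩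
      (Δ₊ γ x - Γ s f (Δ[ s ] f) x - Γ s f (Δ[ s ] f) x) + 2# * Γ s f (Δ[ s ] f) x
        ≈⟨ +-cong (sym (2*half _)) (*-congˡ (Γ[f,Δf] x)) ⟩
      2# * Γ₂ s f f x + 2# * (- μ * γ x)
        ≈⟨ solve 3 (λ a m g → :2 :* a :+ :2 :* (:- m :* g) := :2 :* (a :- m :* g))
             refl (Γ₂ s f f x) μ (γ x) ⟩
      2# * (Γ₂ s f f x - μ * γ x) ∎

    -- The curvature condition in the form of a nonnegative quantity, ready to be added with a
    -- suitable weight.
    curvature : ∀ x → 0# ≤ Γ₂ s f f x - (1/ N * (- μ * f x) ² + K * γ x)
    curvature x = ≤-respʳ-≈
      (+-congˡ (-‿cong (+-congʳ (*-congˡ (*-cong (Δf≈-μf x) (Δf≈-μf x))))))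
      (x≤y⇒0≤y-x (cd f x))

    -- Where f² is maximal, `Δf²` gives `γ m ≤ μ * φ m`; since `γ m` is nonnegative and `φ m`
    -- positive, `μ` cannot be negative.
    μ-pos : 0# < μ
    μ-pos with ∃-argmax φ
    ... | m , φ≤φm = ≤∧≉⇒< (*-cancelʳ-nonneg (<≤⇒< (²-pos (proj₂ nonzero)) (φ≤φm _))
      (≤-respʳ-≈ (solve 2 (λ g p → g :+ (:0 :- (g :- p)) := p) refl (γ m) (μ * φ m))
        (+-nonneg (Γ-nonneg s f m) (x≤y⇒0≤y-x γ-μφ≤0))))
      where
      γ-μφ≤0 : γ m - μ * φ m ≤ 0#
      γ-μφ≤0 = *-cancelˡ-≤ 0<2
        (≤-respʳ-≈ (sym (zeroʳ 2#)) (≤-respˡ-≈ (Δf² m) (Δ-at-maximum φ m φ≤φm)))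
      ≤∧≉⇒< : 0# ≤ μ → 0# < μ
      ≤∧≉⇒< (inj₁ 0<μ) = 0<μ
      ≤∧≉⇒< (inj₂ 0≈μ) = contradiction (sym 0≈μ) μ≉0

    -- Where `γ` is maximal, Bochner and curvature give (K - μ)γ ≤ 0. If `μ < K`, then `γ` is at
    -- most zero everywhere, so μf = -Δσ f = 0, which fails where f is nonzero.
    K≤μ : K ≤ μ
    K≤μ with ∃-argmax γ
    ... | m , γ≤γm = ≮⇒≥ λ μ<K →
      proj₂ nonzero (*-cancelˡ-≈0 μ≉0 (trans (sym (equation _)) (trans
        (-‿cong (Γ≤0⇒Δ≈0 s f _ (≤-trans (γ≤γm _) (γm≤0 μ<K)))) -0#≈0#)))
      where
      0≤-[K-μ]γm : 0# ≤ (K - μ) * - γ m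
      -- Three nonnegative quantities are added: twice the curvature excess, twice the dimension
      -- term (which cancels the one inside the excess), and `0# - Δ₊ γ m`.
      0≤-[K-μ]γm = *-cancelˡ-nonneg 0<2 (≤-respʳ-≈
        (begin
          2# * (Γ₂ s f f m - (1/ N * (- μ * f m) ² + K * γ m)) + 2# * (1/ N * (- μ * f m) ²)
              + (0# - Δ₊ γ m)
            ≈⟨ +-congˡ (+-congˡ (-‿cong (bochner m))) ⟩
          2# * (Γ₂ s f f m - (1/ N * (- μ * f m) ² + K * γ m)) + 2# * (1/ N * (- μ * f m) ²)
              + (0# - 2# * (Γ₂ s f f m - μ * γ m))
            ≈⟨ solve 5 (λ a b k m g →
                 :2 :* (a :- (b :+ k :* g)) :+ :2 :* b :+ (:0 :- :2 :* (a :- m :* g))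
                   := :2 :* ((k :- m) :* :- g))
                 refl (Γ₂ s f f m) (1/ N * (- μ * f m) ²) K μ (γ m) ⟩
          2# * ((K - μ) * - γ m) ∎)
        (+-nonneg
          (+-nonneg (*-nonneg (inj₁ 0<2) (curvature m))
            (*-nonneg (inj₁ 0<2) (*-nonneg (1/N-nonneg N) (²-nonneg _))))
          (x≤y⇒0≤y-x (Δ-at-maximum γ m γ≤γm))))
      γm≤0 : μ < K → γ m ≤ 0#
      γm≤0 μ<K = ≤-from-difference (*-cancelˡ-nonneg (x<y⇒0<y-x μ<K) 0≤-[K-μ]γm)
        (sym (+-identityˡ _))

    -- The gradient estimate.

    module _ (α : Carrier) (α> : α > 2# - 2# * K / μ) where

      D P : Carrier
      D = (α - 2#) * μ + 2# * K
      P = (α ² - 4# * 1/ N) * μ + 2# * K * α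

      F : V → Carrier
      F y = ∣∇_∣² s f y + α * μ * f y ²

      -- `D` is the positive gap in the hypothesis on `α`, multiplied by the positive `μ`.
      D-pos : 0# < D
      D-pos = <-respʳ-≈
        (begin
          (α - (2# - 2# * K * μ ⁻¹)) * μ
            ≈⟨ solve 4 (λ a k m h → (a :- (:2 :- :2 :* k :* h)) :* m
                 := (a :- :2) :* m :+ :2 :* k :* (m :* h)) refl α K μ (μ ⁻¹) ⟩
          (α - 2#) * μ + 2# * K * (μ * μ ⁻¹)
            ≈⟨ +-congˡ (trans (*-congˡ (inverseʳ μ μ≉0)) (*-identityʳ _)) ⟩
          D ∎)
        (*-pos (x<y⇒0<y-x α>) μ-pos)

      -- Here αμ = 2(μ - K) + D, where the first summand is nonnegative by `K≤μ`.
      αμ-pos : 0# < α * μ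
      αμ-pos = <-respʳ-≈
        (solve 3 (λ a k m → :2 :* (m :- k) :+ ((a :- :2) :* m :+ :2 :* k) := a :* m) refl α K μ)
        (+-nonneg-pos (*-nonneg (inj₁ 0<2) (x≤y⇒0≤y-x K≤μ)) D-pos)

      ΔF : ∀ x → Δ₊ F x ≈ 2# * (2# * (Γ₂ s f f x - μ * γ x)) + α * μ * (2# * (γ x - μ * φ x))
      ΔF x = trans (Δ-linear (allPositive G) 2# (α * μ) γ φ x)
        (+-cong (*-congˡ (bochner x)) (*-congˡ (Δf² x)))

      F-at-maximum : ∀ m → (∀ y → F y ≤ F m) → D * F m ≤ P * μ * φ m
      F-at-maximum m F≤Fm = ≤-from-difference
        -- The weight 4 on the curvature inequality cancels the 4Γ₂ in ΔF; the remaining multiple of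
        -- `γ m` is absorbed into `D * F m`.
        (+-nonneg (x≤y⇒0≤y-x (Δ-at-maximum F m F≤Fm))
          (*-nonneg (+-nonneg (inj₁ 0<2) (inj₁ 0<2)) (curvature m)))
        (begin
          (0# - Δ₊ F m) + 4# * (Γ₂ s f f m - (1/ N * (- μ * f m) ² + K * γ m))
            ≈⟨ +-congʳ (+-congˡ (-‿cong (ΔF m))) ⟩
          (0# - (2# * (2# * (Γ₂ s f f m - μ * γ m)) + α * μ * (2# * (γ m - μ * φ m))))
              + 4# * (Γ₂ s f f m - (1/ N * (- μ * f m) ² + K * γ m))
            ≈⟨ solve 7 (λ a g f m al nu k →
                   (:0 :- (:2 :* (:2 :* (a :- m :* g)) :+ al :* m :* (:2 :* (g :- m :* (f :* f)))))
                     :+ (:2 :+ :2) :* (a :- (nu :* ((:- m :* f) :* (:- m :* f)) :+ k :* g))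
                 := ((al :* al :- (:2 :+ :2) :* nu) :* m :+ :2 :* k :* al) :* m :* (f :* f)
                     :- ((al :- :2) :* m :+ :2 :* k) :* (:2 :* g :+ al :* m :* (f :* f)))
                 refl (Γ₂ s f f m) (γ m) (f m) μ α (1/ N) K ⟩
          P * μ * φ m - D * F m ∎)

      F≤fraction : ∀ x → F x ≤ P / D * μ * max φ
      F≤fraction x with ∃-argmax F
      -- The chain is D F(x) ≤ D F(m) ≤ Pμ f(m)² ≤ Pμ max f², and `D` is cancelled at the end.
      ... | m , F≤Fm = *-cancelˡ-≤ D-pos
        (≤-trans (*-monoˡ-≤ (inj₁ D-pos) (F≤Fm x))
          (≤-trans (F-at-maximum m F≤Fm)
            (≤-respʳ-≈ cancel-D (*-monoˡ-≤ Pμ-nonneg (g≤max φ m)))))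
        where
        Fm-pos : 0# < F m
        -- `F m` dominates the value of `F` at a vertex where f is nonzero, and there the term αμf²
        -- is already positive.
        Fm-pos = <≤⇒<
          (+-nonneg-pos (*-nonneg (inj₁ 0<2) (Γ-nonneg s f _)) (*-pos αμ-pos (²-pos (proj₂ nonzero))))
          (F≤Fm (proj₁ nonzero))
        0<Pμφm : 0# < P * μ * φ m
        0<Pμφm = <≤⇒< (*-pos D-pos Fm-pos) (F-at-maximum m F≤Fm)
        φm-pos : 0# < φ m
        φm-pos = ²-pos λ fm≈0 → irrefl
          (sym (trans (*-congˡ (trans (*-congʳ fm≈0) (zeroˡ _))) (zeroʳ _))) 0<Pμφm
        Pμ-nonneg : 0# ≤ P * μ
        -- The formula for `P` does not reveal its sign; it is read off from the positive product
        -- `P * μ * φ m`.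
        Pμ-nonneg = *-cancelʳ-nonneg φm-pos (inj₁ 0<Pμφm)
        cancel-D : P * μ * max φ ≈ D * (P / D * μ * max φ)
        cancel-D = begin
          P * μ * max φ                ≈⟨ *-identityˡ _ ⟨
          1# * (P * μ * max φ)         ≈⟨ *-congʳ (inverseʳ D (pos⇒≉0 D-pos)) ⟨
          D * D ⁻¹ * (P * μ * max φ)
            ≈⟨ solve 5 (λ d h p m x → d :* h :* (p :* m :* x) := d :* (p :* h :* m :* x))
                 refl D (D ⁻¹) P μ (max φ) ⟩
          D * (P / D * μ * max φ)      ∎

theorem3p1 :
    ∀ {c ℓ₁ ℓ₂} (ℝ : RealField c ℓ₁ ℓ₂) →
    let open RealField ℝ
        open SignedCalculus ℝ
    in
    ∀ {n : ℕ} (G : Graph (suc n)) → Graph.Connected G →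
    (s : Signing G) (K : Carrier) (N : Dimension) → CD s K N →
    (μ : Carrier) → ¬ (μ ≈ 0#) →
    (f : Fin (suc n) → Carrier) → IsEigenfunction s μ f →
    (x : Fin (suc n)) (α : Carrier) → α > 2# - 2# * K / μ →
    ∣∇_∣² s f x + α * μ * (f x) ²
      ≤ ((α ² - 4# * 1/ N) * μ + 2# * K * α) / ((α - 2#) * μ + 2# * K)
          * μ * max (λ z → (f z) ²)
theorem3p1 ℝ G _ s K N cd μ μ≉0 f eigen x α α> =
  EigenfunctionEstimate.F≤fraction ℝ G s K N cd μ μ≉0 f eigen α α> x
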